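{- For every $n \geq 1$, the mixed page number of the complete bipartite graph $K_{n,n}$ is at least $\lceil \frac{n}{3} \rceil$.
   Context: Given a total vertex order $\prec$, two edges $(a_1,b_1)$, $(a_2,b_2)$ with four distinct endpoints and $a_1\prec b_1$, $a_2 \prec b_2$, $a_1 \prec a_2$ are said to cross if $a_1 \prec a_2 \prec b_1 \prec b_2$, and to nest if $a_1 \prec a_2 \prec b_2 \prec b_1$. A stack is a set of edges no two of which cross; a queue is a set of edges no two of which nest. The mixed page number of a graph $G$ is the minimum value of $s+q$ such that there is a total order of the vertices of $G$ (arbitrary, not necessarily separating the parts) and a partition of its edges into $s$ stacks and $q$ queues with respect to that order. -}

module Defs where

open import Data.Nat using (ℕ; _+_; _<_; _≤_; _⊔_; _⊓_)
open import Data.Nat.DivMod using (_/_)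
open import Data.Fin using (Fin)
open import Data.Sum using (_⊎_; inj₁; inj₂)
open import Data.Product using (_×_)
open import Relation.Binary.PropositionalEquality using (_≡_)
open import Relation.Nullary using (¬_)
open import Function.Definitions using (Injective)

Vertex : ℕ → Set
Vertex n = Fin n ⊎ Fin n

-- Edges of K_{n,n}: exactly the pairs (inj₁ i , inj₂ j); an edge is named by (i , j).
Edge : ℕ → Set
Edge n = Fin n × Fin n

-- A total vertex order is given by an injective position map into ℕ:
-- u ≺ v  iff  pos u < pos v.
record VertexOrder (n : ℕ) : Set where
  field
    pos       : Vertex n → ℕ
    pos-inj   : Injective _≡_ _≡_ pos

open VertexOrder public

endL endR : ∀ {n} → VertexOrder n → Edge n → ℕ
endL σ (i Data.Product., j) = pos σ (inj₁ i) ⊓ pos σ (inj₂ j)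
endR σ (i Data.Product., j) = pos σ (inj₁ i) ⊔ pos σ (inj₂ j)

-- a₁ ≺ a₂ ≺ b₁ ≺ b₂ (strict chain forces four distinct endpoints)
CrossOrdered : ∀ {n} → VertexOrder n → Edge n → Edge n → Set
CrossOrdered σ e f =
  (endL σ e < endL σ f) × (endL σ f < endR σ e) × (endR σ e < endR σ f)

NestOrdered : ∀ {n} → VertexOrder n → Edge n → Edge n → Set
NestOrdered σ e f =
  (endL σ e < endL σ f) × (endL σ f < endR σ f) × (endR σ f < endR σ e)

Cross : ∀ {n} → VertexOrder n → Edge n → Edge n → Set
Cross σ e f = CrossOrdered σ e f ⊎ CrossOrdered σ f e

Nest : ∀ {n} → VertexOrder n → Edge n → Edge n → Set
Nest σ e f = NestOrdered σ e f ⊎ NestOrdered σ f e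

record MixedLayout (n s q : ℕ) : Set where
  field
    order      : VertexOrder n
    page       : Edge n → Fin s ⊎ Fin q
    stack-ok   : ∀ e f (k : Fin s) → page e ≡ inj₁ k → page f ≡ inj₁ k →
                 ¬ Cross order e f
    queue-ok   : ∀ e f (k : Fin q) → page e ≡ inj₂ k → page f ≡ inj₂ k →
                 ¬ Nest order e f

⌈_/3⌉ : ℕ → ℕ
⌈ n /3⌉ = (n + 2) / 3

{-# OPTIONS --safe #-}
module Submission where

-- Number the vertices 0, …, 2n - 1 along the order and consider the edges (x, y) whose sum
-- x + y is one of the 2n - 1 central values n, …, 3n - 2.
-- * Edges of equal sum nest, so a queue contains at most 2n - 1 of them.
-- * A stack of bichromatic edges that are not between consecutive vertices has about 2n
--   edges, and fewer if many consecutive vertices differ in colour; since an edge between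
--   consecutive vertices is on one page only, s stacks contain at most s (2n - 1) + n / 2.
-- * A pair with x + y < n lies in a unique triple x + y + z = n - 1, and at most two of the
--   three pairs of a triple are bichromatic. Hence at most n (n + 1) / 6 edges have sum
--   below n, and by symmetry the same holds for the sums above 3n - 2.
-- So 2n²/3 - n/3 ≤ (s + q)(2n - 1) + n/2, which fails for 3 (s + q) < n, unless s + q = 0.

open import Defs
open import Data.Nat using (ℕ; zero; suc; _≤_; _<_; _+_; _*_; _∸_; z≤n; s≤s; s≤s⁻¹; _≤?_; _<?_; _≟_)
open import Data.Nat.Properties
open import Data.Nat.DivMod using (_/_; /-monoˡ-≤; +-distrib-/-∣ˡ; m*n/n≡m)
open import Data.Nat.Divisibility using (n∣m*n)
open import Data.Nat.Induction using (<-rec)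
open import Data.Nat.ListAction using (sum)
open import Data.Nat.ListAction.Properties using (sum-++; sum-↭)
open import Data.Nat.Tactic.RingSolver using (solve-∀)
open import Data.Bool using (Bool; true; false)
open import Data.Empty using (⊥; ⊥-elim)
open import Data.Fin using (Fin; zero; toℕ; join; splitAt)
open import Data.Fin.Properties using (toℕ-injective; toℕ<n; toℕ-↑ˡ; toℕ-↑ʳ; splitAt-join)
open import Data.List using (List; []; _∷_; _++_; length; map; allFin)
open import Data.List.Membership.Propositional.Properties using (∈-map⁻)
open import Data.List.Properties using (length-++; length-map; length-tabulate; map-++; map-∘)
open import Data.List.Relation.Binary.Disjoint.Propositional using (Disjoint)
open import Data.List.Relation.Binary.Permutation.Propositional using (↭-sym; ↭⇒↭ₛ)
open import Data.List.Relation.Binary.Permutation.Propositional.Properties using (↭-length; map⁺)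
open import Data.List.Relation.Unary.All using (All; []; _∷_)
open import Data.List.Relation.Unary.AllPairs as AllPairs using (AllPairs; []; _∷_)
open import Data.List.Relation.Unary.Sorted.TotalOrder.Properties using (Sorted⇒AllPairs)
open import Data.List.Relation.Unary.Unique.Propositional using (Unique)
open import Data.Product using (_×_; _,_; ∃-syntax; proj₁; proj₂)
open import Data.Sum using (_⊎_; inj₁; inj₂)
open import Function using (_∘_; flip)
open import Relation.Binary using (tri<; tri≈; tri>)
open import Relation.Binary.PropositionalEquality using (_≡_; refl; sym; trans; cong; cong₂; subst; subst₂; setoid; module ≡-Reasoning)
open import Relation.Nullary using (¬_; Dec; yes; no; contradiction)
open import Relation.Nullary.Decidable using (_×-dec_)
open import Data.List.Relation.Binary.Permutation.Setoid.Properties using (Unique-resp-↭)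
import Data.List.Relation.Unary.Unique.Propositional.Properties as Unique
import Relation.Binary.Construct.On as On

-- Finite sums

∑ : ℕ → (ℕ → ℕ) → ℕ
∑ zero    f = 0
∑ (suc n) f = f 0 + ∑ n (f ∘ suc)

∑-mono : ∀ n {f g : ℕ → ℕ} → (∀ i → i < n → f i ≤ g i) → ∑ n f ≤ ∑ n g
∑-mono zero    h = z≤n
∑-mono (suc n) h = +-mono-≤ (h 0 (s≤s z≤n)) (∑-mono n (λ i i<n → h (suc i) (s≤s i<n)))

∑-cong : ∀ n {f g : ℕ → ℕ} → (∀ i → i < n → f i ≡ g i) → ∑ n f ≡ ∑ n g
∑-cong zero    h = refl
∑-cong (suc n) h = cong₂ _+_ (h 0 (s≤s z≤n)) (∑-cong n (λ i i<n → h (suc i) (s≤s i<n)))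

∑-const : ∀ n c → ∑ n (λ _ → c) ≡ n * c
∑-const zero    c = refl
∑-const (suc n) c = cong (c +_) (∑-const n c)

∑-zero : ∀ n {f : ℕ → ℕ} → (∀ i → i < n → f i ≡ 0) → ∑ n f ≡ 0
∑-zero n h = trans (∑-cong n h) (trans (∑-const n 0) (*-zeroʳ n))

∑-+ : ∀ n (f g : ℕ → ℕ) → ∑ n (λ i → f i + g i) ≡ ∑ n f + ∑ n g
∑-+ zero    f g = refl
∑-+ (suc n) f g = trans (cong (f 0 + g 0 +_) (∑-+ n (f ∘ suc) (g ∘ suc)))
                        (interchange (f 0) (g 0) (∑ n (f ∘ suc)) (∑ n (g ∘ suc)))
  where
  interchange : ∀ a b c d → a + b + (c + d) ≡ a + c + (b + d)
  interchange = solve-∀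

∑-*ˡ : ∀ n c (f : ℕ → ℕ) → ∑ n (λ i → c * f i) ≡ c * ∑ n f
∑-*ˡ zero    c f = sym (*-zeroʳ c)
∑-*ˡ (suc n) c f = trans (cong (c * f 0 +_) (∑-*ˡ n c (f ∘ suc))) (sym (*-distribˡ-+ c (f 0) _))

∑-split : ∀ m n (f : ℕ → ℕ) → ∑ (m + n) f ≡ ∑ m f + ∑ n (λ i → f (m + i))
∑-split zero    n f = refl
∑-split (suc m) n f = trans (cong (f 0 +_) (∑-split m n (f ∘ suc))) (sym (+-assoc (f 0) _ _))

∑-last : ∀ n (f : ℕ → ℕ) → ∑ (suc n) f ≡ ∑ n f + f n
∑-last zero    f = +-comm (f 0) 0
∑-last (suc n) f = trans (cong (f 0 +_) (∑-last n (f ∘ suc))) (sym (+-assoc (f 0) _ _))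

∑-swap : ∀ m n (f : ℕ → ℕ → ℕ) → ∑ m (λ i → ∑ n (f i)) ≡ ∑ n (λ j → ∑ m (λ i → f i j))
∑-swap zero    n f = sym (∑-zero n (λ _ _ → refl))
∑-swap (suc m) n f = trans (cong (∑ n (f 0) +_) (∑-swap m n (f ∘ suc)))
                           (sym (∑-+ n (f 0) (λ j → ∑ m (λ i → f (suc i) j))))

∑-reverse : ∀ n (f : ℕ → ℕ) → ∑ n (λ i → f (n ∸ suc i)) ≡ ∑ n f
∑-reverse zero    f = refl
∑-reverse (suc n) f = begin
  f n + ∑ n (λ i → f (n ∸ suc i))  ≡⟨ cong (f n +_) (∑-reverse n f) ⟩
  f n + ∑ n f                      ≡⟨ +-comm (f n) _ ⟩
  ∑ n f + f n                      ≡⟨ ∑-last n f ⟨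
  ∑ (suc n) f                      ∎
  where open ≡-Reasoning

∑-monoˡ : ∀ {m n} (f : ℕ → ℕ) → m ≤ n → ∑ m f ≤ ∑ n f
∑-monoˡ f z≤n       = z≤n
∑-monoˡ f (s≤s m≤n) = +-monoʳ-≤ (f 0) (∑-monoˡ (f ∘ suc) m≤n)

term≤∑ : ∀ {k n} (f : ℕ → ℕ) → k < n → f k ≤ ∑ n f
term≤∑ {zero}  f (s≤s _)   = m≤m+n (f 0) _
term≤∑ {suc k} f (s≤s k<n) = ≤-trans (term≤∑ (f ∘ suc) k<n) (m≤n+m _ (f 0))

∑-positive : ∀ n (f : ℕ → ℕ) → 0 < ∑ n f → ∃[ i ] i < n × 0 < f i
∑-positive (suc n) f p with f 0 in eq
... | suc _ = 0 , s≤s z≤n , subst (0 <_) (sym eq) (s≤s z≤n)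
... | zero with ∑-positive n (f ∘ suc) p
...   | i , i<n , q = suc i , s≤s i<n , q

∑-unique : ∀ n (f : ℕ → ℕ) → (∀ i → i < n → f i ≤ 1) →
           (∀ i j → i < n → j < n → 0 < f i → 0 < f j → i ≡ j) → ∑ n f ≤ 1
∑-unique zero    f b u = z≤n
∑-unique (suc n) f b u with f 0 in eq
... | zero  = ∑-unique n (f ∘ suc) (λ i i<n → b (suc i) (s≤s i<n))
                (λ i j i<n j<n p q → suc-injective (u (suc i) (suc j) (s≤s i<n) (s≤s j<n) p q))
... | suc a = ≤-trans (≤-reflexive (trans (cong (suc a +_) (∑-zero n rest)) (+-identityʳ (suc a))))
                (subst (_≤ 1) eq (b 0 (s≤s z≤n)))
  where
  rest : ∀ i → i < n → f (suc i) ≡ 0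
  rest i i<n with f (suc i) in eq′
  ... | zero  = refl
  ... | suc _ with u 0 (suc i) (s≤s z≤n) (s≤s i<n) (subst (0 <_) (sym eq) (s≤s z≤n)) (subst (0 <_) (sym eq′) (s≤s z≤n))
  ...   | ()

-- Sums over squares, over pairs i < j, and over the triangle i + j < n

∑² : ℕ → (ℕ → ℕ → ℕ) → ℕ
∑² n g = ∑ n (λ i → ∑ n (g i))

∑< : ℕ → (ℕ → ℕ → ℕ) → ℕ
∑< n g = ∑ n (λ j → ∑ j (λ i → g i j))

∑△ : ℕ → (ℕ → ℕ → ℕ) → ℕ
∑△ n g = ∑ n (λ i → ∑ (n ∸ i) (g i))

∑<-mono : ∀ n {g h : ℕ → ℕ → ℕ} → (∀ i j → i < j → j < n → g i j ≤ h i j) → ∑< n g ≤ ∑< n h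
∑<-mono n p = ∑-mono n (λ j j<n → ∑-mono j (λ i i<j → p i j i<j j<n))

∑<-∑ : ∀ n m (g : ℕ → ℕ → ℕ → ℕ) → ∑< n (λ i j → ∑ m (λ k → g k i j)) ≡ ∑ m (λ k → ∑< n (g k))
∑<-∑ n m g = trans (∑-cong n (λ j _ → ∑-swap j m (λ i k → g k i j)))
                   (∑-swap n m (λ j k → ∑ j (λ i → g k i j)))

∑<-unique : ∀ n (g : ℕ → ℕ → ℕ) → (∀ i j → i < j → j < n → g i j ≤ 1) →
            (∀ i j i′ j′ → i < j → j < n → i′ < j′ → j′ < n → 0 < g i j → 0 < g i′ j′ → i ≡ i′ × j ≡ j′) →
            ∑< n g ≤ 1
∑<-unique n g b u = ∑-unique n _
  (λ j j<n → ∑-unique j _ (λ i i<j → b i j i<j j<n)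
    (λ i i′ i<j i′<j p q → proj₁ (u i j i′ j i<j j<n i′<j j<n p q)))
  λ j j′ j<n j′<n p q →
    let i  , i<j   , p′ = ∑-positive j  _ p
        i′ , i′<j′ , q′ = ∑-positive j′ _ q
    in proj₂ (u i j i′ j′ i<j j<n i′<j′ j′<n p′ q′)

-- Passes from ordered pairs, which are easy to count row by row, to edges. The induction peels off
-- the last row and the last column, which agree by symmetry and meet in a zero.
∑²-symmetric : ∀ n (g : ℕ → ℕ → ℕ) → (∀ i j → g i j ≡ g j i) → (∀ i → g i i ≡ 0) →
               ∑² n g ≡ ∑< n g + ∑< n g
∑²-symmetric zero    g s d = refl
∑²-symmetric (suc n) g s d = begin
  ∑ (suc n) (λ i → ∑ (suc n) (g i))                         ≡⟨ ∑-cong (suc n) (λ i _ → ∑-last n (g i)) ⟩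
  ∑ (suc n) (λ i → ∑ n (g i) + g i n)                       ≡⟨ ∑-+ (suc n) (λ i → ∑ n (g i)) (λ i → g i n) ⟩
  ∑ (suc n) (λ i → ∑ n (g i)) + ∑ (suc n) (λ i → g i n)     ≡⟨ cong₂ _+_ (∑-last n (λ i → ∑ n (g i))) (∑-last n (λ i → g i n)) ⟩
  ∑² n g + ∑ n (g n) + (∑ n (λ i → g i n) + g n n)          ≡⟨ cong₂ (λ a b → a + ∑ n (g n) + (∑ n (λ i → g i n) + b)) (∑²-symmetric n g s d) (d n) ⟩
  ∑< n g + ∑< n g + ∑ n (g n) + (c + 0)                     ≡⟨ cong (λ a → ∑< n g + ∑< n g + a + (c + 0)) (∑-cong n (λ i _ → s n i)) ⟩
  ∑< n g + ∑< n g + c + (c + 0)                             ≡⟨ rearrange (∑< n g) c ⟩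
  (∑< n g + c) + (∑< n g + c)                               ≡⟨ cong₂ _+_ (∑-last n _) (∑-last n _) ⟨
  ∑< (suc n) g + ∑< (suc n) g                               ∎
  where
  open ≡-Reasoning
  c = ∑ n (λ i → g i n)
  rearrange : ∀ a b → a + a + b + (b + 0) ≡ (a + b) + (a + b)
  rearrange = solve-∀

∑△-+ : ∀ n (g h : ℕ → ℕ → ℕ) → ∑△ n (λ i j → g i j + h i j) ≡ ∑△ n g + ∑△ n h
∑△-+ n g h = trans (∑-cong n (λ i _ → ∑-+ (n ∸ i) (g i) (h i))) (∑-+ n _ _)

-- Peels off the column `j = 0`, whereas the recursion of `∑△` peels off the row `i = 0`; comparing
-- the two gives the symmetry of the triangle.
∑△-sucˡ : ∀ n (g : ℕ → ℕ → ℕ) → ∑△ (suc n) g ≡ ∑ (suc n) (λ i → g i 0) + ∑△ n (λ i j → g i (suc j))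
∑△-sucˡ zero    g = refl
∑△-sucˡ (suc n) g = begin
  g 0 0 + r + ∑△ (suc n) (g ∘ suc)             ≡⟨ cong (g 0 0 + r +_) (∑△-sucˡ n (g ∘ suc)) ⟩
  g 0 0 + r + (s + t)                          ≡⟨ interchange (g 0 0) r s t ⟩
  g 0 0 + s + (r + t)                          ∎
  where
  open ≡-Reasoning
  r = ∑ (suc n) (λ j → g 0 (suc j))
  s = ∑ (suc n) (λ i → g (suc i) 0)
  t = ∑△ n (λ i j → g (suc i) (suc j))
  interchange : ∀ a b c d → a + b + (c + d) ≡ a + c + (b + d)
  interchange = solve-∀

∑△-flip : ∀ n (g : ℕ → ℕ → ℕ) → ∑△ n (flip g) ≡ ∑△ n g
∑△-flip zero    g = refl
∑△-flip (suc n) g = trans (cong (∑ (suc n) (λ j → g j 0) +_) (∑△-flip n (λ i j → g i (suc j))))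
                          (sym (∑△-sucˡ n g))

-- Within row `i`, replaces `j` by the third member `n - 1 - i - j` of the triple through `i` and
-- `j`.
∑△-reverse : ∀ n (g : ℕ → ℕ → ℕ) → ∑△ n (λ i j → g i (n ∸ i ∸ suc j)) ≡ ∑△ n g
∑△-reverse n g = ∑-cong n (λ i _ → ∑-reverse (n ∸ i) (g i))

∑△-const : ∀ n c → 2 * ∑△ n (λ _ _ → c) ≡ n * suc n * c
∑△-const zero    c = refl
∑△-const (suc n) c = begin
  2 * (∑ (suc n) (λ _ → c) + ∑△ n (λ _ _ → c))       ≡⟨ cong (λ a → 2 * (a + ∑△ n (λ _ _ → c))) (∑-const (suc n) c) ⟩
  2 * (suc n * c + ∑△ n (λ _ _ → c))                 ≡⟨ *-distribˡ-+ 2 (suc n * c) _ ⟩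
  2 * (suc n * c) + 2 * ∑△ n (λ _ _ → c)             ≡⟨ cong (2 * (suc n * c) +_) (∑△-const n c) ⟩
  2 * (suc n * c) + n * suc n * c                    ≡⟨ rearrange n c ⟩
  suc n * suc (suc n) * c                            ∎
  where
  open ≡-Reasoning
  rearrange : ∀ n c → 2 * ((1 + n) * c) + n * (1 + n) * c ≡ (1 + n) * (1 + (1 + n)) * c
  rearrange = solve-∀

-- Colourings

-- Numerical indicators of unequal and equal colours, so that colours enter sums directly. The
-- colours are the two parts, hence `δ` is adjacency in the complete bipartite graph.
δ μ : Bool → Bool → ℕ
δ true  false = 1
δ false true  = 1
δ _     _     = 0
μ true  true  = 1
μ false false = 1
μ _     _     = 0

δ-sym : ∀ a b → δ a b ≡ δ b a
δ-sym true  true  = refl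
δ-sym true  false = refl
δ-sym false true  = refl
δ-sym false false = refl

δ-self : ∀ a → δ a a ≡ 0
δ-self true  = refl
δ-self false = refl

δ≤1 : ∀ a b → δ a b ≤ 1
δ≤1 true  true  = z≤n
δ≤1 true  false = ≤-refl
δ≤1 false true  = ≤-refl
δ≤1 false false = z≤n

μ+δ≡1 : ∀ a b → μ a b + δ a b ≡ 1
μ+δ≡1 true  true  = refl
μ+δ≡1 true  false = refl
μ+δ≡1 false true  = refl
μ+δ≡1 false false = refl

-- Two of three vertices share one of the two colours.
δ-triangle : ∀ a b c → δ a b + δ a c + δ b c ≤ 2
δ-triangle true  true  true  = z≤n
δ-triangle true  true  false = ≤-refl
δ-triangle true  false true  = ≤-refl
δ-triangle true  false false = ≤-refl
δ-triangle false true  true  = ≤-refl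
δ-triangle false true  false = ≤-refl
δ-triangle false false true  = ≤-refl
δ-triangle false false false = z≤n

-- Each pair i + j < n lies in exactly one triple with i + j + k = n - 1, so that
-- 3 times the sum is the number of bichromatic pairs over all such triples.
∑△-δ≤ : ∀ n (c : ℕ → Bool) → 3 * ∑△ n (λ i j → δ (c i) (c j)) ≤ n * suc n
∑△-δ≤ n c = begin
  3 * ∑△ n d                                             ≡⟨ 3*≡ (∑△ n d) ⟩
  ∑△ n d + ∑△ n d + ∑△ n d                               ≡⟨ cong₂ (λ a b → ∑△ n d + a + b) (sym (∑△-reverse n d)) (sym third) ⟩
  ∑△ n d + ∑△ n (λ i j → d i (k i j)) + ∑△ n (λ i j → d j (k i j))
                                                         ≡⟨ cong (_+ ∑△ n (λ i j → d j (k i j))) (∑△-+ n d (λ i j → d i (k i j))) ⟨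
  ∑△ n (λ i j → d i j + d i (k i j)) + ∑△ n (λ i j → d j (k i j))
                                                         ≡⟨ ∑△-+ n _ _ ⟨
  ∑△ n (λ i j → d i j + d i (k i j) + d j (k i j))       ≤⟨ ∑-mono n (λ i _ → ∑-mono (n ∸ i) (λ j _ → δ-triangle (c i) (c j) (c (k i j)))) ⟩
  ∑△ n (λ _ _ → 2)                                       ≡⟨ *-cancelˡ-≡ _ _ 2 (trans (∑△-const n 2) (*-comm (n * suc n) 2)) ⟩
  n * suc n                                              ∎
  where
  open ≤-Reasoning
  d : ℕ → ℕ → ℕ
  d i j = δ (c i) (c j)
  k : ℕ → ℕ → ℕ
  k i j = n ∸ i ∸ suc j
  -- The third member is symmetric in `i` and `j`, so exchanging them turns the pairs `(j, k)` into
  -- the pairs `(i, k)`, and `∑△-reverse` turns these into `(i, j)`.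
  third : ∑△ n (λ i j → d j (k i j)) ≡ ∑△ n d
  third = trans (∑-cong n (λ i _ → ∑-cong (n ∸ i) (λ j _ → cong (d j) (k-sym i j))))
                (trans (∑△-flip n (λ i j → d i (k i j))) (∑△-reverse n d))
    where
    k-sym : ∀ i j → k i j ≡ k j i
    k-sym i j = trans (∸-+-assoc n i (suc j))
      (trans (cong (n ∸_) (trans (+-suc i j) (trans (cong suc (+-comm i j)) (sym (+-suc j i)))))
        (sym (∸-+-assoc n j (suc i))))
  3*≡ : ∀ a → 3 * a ≡ a + a + a
  3*≡ = solve-∀

-- Stacks

∑<-last : ∀ n (g : ℕ → ℕ → ℕ) → ∑< (suc n) g ≡ ∑< n g + ∑ n (λ i → g i n)
∑<-last n g = ∑-last n (λ j → ∑ j (λ i → g i j))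

shift : ℕ → (ℕ → ℕ → ℕ) → ℕ → ℕ → ℕ
shift k g i j = g (k + i) (k + j)

-- When no edge passes over `k`, each edge lies in `[0, k]` or in `[k, k + r]`. The intervals share
-- only the vertex `k`, so no edge is counted twice.
∑<-split : ∀ k r (g : ℕ → ℕ → ℕ) → (∀ i j → i < k → k < j → j ≤ k + r → g i j ≡ 0) →
           ∑< (suc (k + r)) g ≡ ∑< (suc k) g + ∑< (suc r) (shift k g)
∑<-split k zero    g z = trans (cong (λ a → ∑< (suc a) g) (+-identityʳ k)) (sym (+-identityʳ _))
∑<-split k (suc r) g z = begin
  ∑< (suc (k + suc r)) g                                     ≡⟨ ∑<-last (k + suc r) g ⟩
  ∑< (k + suc r) g + ∑ (k + suc r) col                       ≡⟨ cong₂ _+_ left right ⟩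
  ∑< (suc k) g + ∑< (suc r) (shift k g) + ∑ (suc r) (λ i → col (k + i))
                                                             ≡⟨ +-assoc (∑< (suc k) g) _ _ ⟩
  ∑< (suc k) g + (∑< (suc r) (shift k g) + ∑ (suc r) (λ i → col (k + i)))
                                                             ≡⟨ cong (∑< (suc k) g +_) (∑<-last (suc r) (shift k g)) ⟨
  ∑< (suc k) g + ∑< (suc (suc r)) (shift k g)                ∎
  where
  open ≡-Reasoning
  col = λ i → g i (k + suc r)
  left : ∑< (k + suc r) g ≡ ∑< (suc k) g + ∑< (suc r) (shift k g)
  left = trans (cong (λ a → ∑< a g) (+-suc k r))
    (∑<-split k r g (λ i j i<k k<j j≤ → z i j i<k k<j (≤-trans j≤ (+-monoʳ-≤ k (n≤1+n r)))))
  right : ∑ (k + suc r) col ≡ ∑ (suc r) (λ i → col (k + i))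
  right = trans (∑-split k (suc r) col)
    (cong (_+ ∑ (suc r) (λ i → col (k + i)))
      (∑-zero k (λ i i<k → z i (k + suc r) i<k (m<m+n k (s≤s z≤n)) ≤-refl)))

-- The same cut, at the vertex `suc k`, except that the outermost edge `(0, L)` may pass over it and
-- is counted separately.
∑<-split-chord : ∀ k r (g : ℕ → ℕ → ℕ) → let L = suc k + suc r in
  (∀ i j → i < suc k → suc k < j → j ≤ L → (0 < i ⊎ j < L) → g i j ≡ 0) →
  ∑< (suc L) g ≡ ∑< (suc (suc k)) g + ∑< (suc (suc r)) (shift (suc k) g) + g 0 L
∑<-split-chord k r g z = begin
  ∑< (suc L) g                                       ≡⟨ ∑<-last L g ⟩
  ∑< L g + ∑ L col                                   ≡⟨ cong₂ _+_ left right ⟩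
  A + B + (g 0 L + C)                                ≡⟨ rearrange A B (g 0 L) C ⟩
  A + (B + C) + g 0 L                                ≡⟨ cong (λ a → A + a + g 0 L) (∑<-last (suc r) (shift (suc k) g)) ⟨
  A + ∑< (suc (suc r)) (shift (suc k) g) + g 0 L     ∎
  where
  open ≡-Reasoning
  L = suc k + suc r
  col = λ i → g i L
  A = ∑< (suc (suc k)) g
  B = ∑< (suc r) (shift (suc k) g)
  C = ∑ (suc r) (λ i → col (suc k + i))
  sucL : suc (suc k + r) ≡ L
  sucL = sym (+-suc (suc k) r)
  left : ∑< L g ≡ A + B
  left = trans (cong (λ a → ∑< a g) (+-suc (suc k) r))
    (∑<-split (suc k) r g (λ i j i<k k<j j≤ →
      z i j i<k k<j (≤-trans j≤ (+-monoʳ-≤ (suc k) (n≤1+n r)))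
        (inj₂ (≤-trans (s≤s j≤) (≤-reflexive sucL)))))
  right : ∑ L col ≡ g 0 L + C
  right = trans (∑-split (suc k) (suc r) col) (cong (_+ C)
    (trans (cong (g 0 L +_) (∑-zero k (λ i i<k →
        z (suc i) L (s≤s i<k) (m<m+n (suc k) (s≤s z≤n)) ≤-refl (inj₁ (s≤s z≤n)))))
      (+-identityʳ (g 0 L))))
  rearrange : ∀ a b x c → a + b + (x + c) ≡ a + (b + c) + x
  rearrange = solve-∀

NonCrossing : ℕ → (ℕ → ℕ → ℕ) → Set
NonCrossing L e = ∀ i i′ j j′ → i < i′ → i′ < j → j < j′ → j′ ≤ L → 0 < e i j → 0 < e i′ j′ → ⊥

-- Supplies the cut vertex `suc k` of the interval `[0, b + 2]`: the last neighbour of `0` before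
-- the right end, or the vertex `1` if there is none.
last-neighbour : ∀ b (e : ℕ → ℕ → ℕ) →
  ∃[ k ] k ≤ b × (k ≡ 0 ⊎ 0 < e 0 (suc k)) × (∀ j → suc k < j → j ≤ suc b → e 0 j ≡ 0)
last-neighbour zero    e = 0 , z≤n , inj₁ refl , λ j p q → contradiction q (<⇒≱ p)
last-neighbour (suc b) e with e 0 (suc (suc b)) in eq
... | suc _ = suc b , ≤-refl , inj₂ (subst (0 <_) (sym eq) (s≤s z≤n)) , λ j p q → contradiction q (<⇒≱ p)
... | zero with last-neighbour b e
...   | k , k≤b , h , z = k , m≤n⇒m≤1+n k≤b , h , z′
  where
  z′ : ∀ j → suc k < j → j ≤ suc (suc b) → e 0 j ≡ 0
  z′ j p q with m≤n⇒m<n∨m≡n q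
  ... | inj₁ (s≤s j≤) = z j p j≤
  ... | inj₂ refl     = eq

-- For `x = 0` the summand `1` suffices. For `x = 1` the colours `a` and `c` differ, so `b` agrees
-- with exactly one of them and both sides equal `2`.
chord-parity : ∀ a b c x → x ≤ δ a c → 2 * x + μ a c ≤ μ a b + μ b c + 1
chord-parity true  true  true  zero    p       = s≤s z≤n
chord-parity true  false true  zero    p       = ≤-refl
chord-parity false true  false zero    p       = ≤-refl
chord-parity false false false zero    p       = s≤s z≤n
chord-parity true  b     false zero    p       = z≤n
chord-parity false b     true  zero    p       = z≤n
chord-parity true  true  false (suc _) (s≤s z≤n) = ≤-refl
chord-parity true  false false (suc _) (s≤s z≤n) = ≤-refl
chord-parity false true  true  (suc _) (s≤s z≤n) = ≤-refl
chord-parity false false true  (suc _) (s≤s z≤n) = ≤-refl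

-- The weight of the gap between two consecutive vertices. Edges of consecutive vertices are kept
-- apart because they cross nothing and could otherwise be charged to every page.
spineWeight : (ℕ → Bool) → (ℕ → ℕ → ℕ) → ℕ → ℕ
spineWeight c e i = μ (c i) (c (suc i)) + 2 * e i (suc i)

-- The strengthening by μ makes the induction work: cutting [0, L] at a vertex k that no
-- edge other than (0, L) passes over, if 0 and L differ in colour then k agrees with one
-- of them, and the gain there pays for the edge (0, L).
stack-bound : ∀ L (c : ℕ → Bool) (e : ℕ → ℕ → ℕ) → 0 < L →
  (∀ i j → e i j ≤ δ (c i) (c j)) → NonCrossing L e →
  2 * ∑< (suc L) e + μ (c 0) (c L) + 1 ≤ L + ∑ L (spineWeight c e)
stack-bound = <-rec _ step
  where
  Bound : ℕ → Set
  Bound L = ∀ (c : ℕ → Bool) (e : ℕ → ℕ → ℕ) → 0 < L →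
    (∀ i j → e i j ≤ δ (c i) (c j)) → NonCrossing L e →
    2 * ∑< (suc L) e + μ (c 0) (c L) + 1 ≤ L + ∑ L (spineWeight c e)
  base : ∀ x m → 2 * (x + 0 + 0) + m + 1 ≡ 1 + (m + 2 * x + 0)
  base = solve-∀
  step : ∀ L → (∀ {l} → l < L → Bound l) → Bound L
  step 1 ih c e _ bi nc = ≤-reflexive (base (e 0 1) (μ (c 0) (c 1)))
  step L@(suc (suc b)) ih c e _ bi nc with last-neighbour b e
  ... | k , k≤b , h , z with m≤n⇒∃[o]m+o≡n k≤b
  -- The length is rewritten as `suc k + suc r`, the sum of the lengths of the two intervals of the
  -- cut, both of which are shorter than `L`.
  ...   | r , refl = subst (λ l → 2 * ∑< (suc l) e + μ (c 0) (c l) + 1 ≤ l + ∑ l (spineWeight c e))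
                      (+-suc (suc k) r) main
    where
    L′ = suc k + suc r
    L≡ : L′ ≡ L
    L≡ = +-suc (suc k) r
    shift-+ : ∀ x → suc k + suc x ≡ suc (suc k + x)
    shift-+ = +-suc (suc k)
    nothing-above : ∀ i j → i < suc k → suc k < j → j ≤ L′ → (0 < i ⊎ j < L′) → e i j ≡ 0
    nothing-above zero j _ k<j _ (inj₂ j<L) = z j k<j (s≤s⁻¹ (≤-trans j<L (≤-reflexive L≡)))
    -- An edge from `i > 0` over the cut would cross the edge `(0, suc k)`; if `k = 0`, there is no
    -- vertex strictly between `0` and the cut.
    nothing-above i@(suc _) j i<k k<j j≤L _ = n<1⇒n≡0 (≰⇒> λ p → uncovered h p)
      where
      uncovered : k ≡ 0 ⊎ 0 < e 0 (suc k) → ¬ 0 < e i j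
      uncovered (inj₁ k≡0) p = contradiction (subst (λ a → i < suc a) k≡0 i<k) (≤⇒≯ (s≤s z≤n))
      uncovered (inj₂ q)   p = nc 0 i (suc k) j (s≤s z≤n) i<k k<j (≤-trans j≤L (≤-reflexive L≡)) q p
    E₁ = ∑< (suc (suc k)) e
    E₂ = ∑< (suc (suc r)) (shift (suc k) e)
    S₁ = ∑ (suc k) (spineWeight c e)
    S₂ = ∑ (suc r) (λ i → spineWeight c e (suc k + i))
    μ₁ = μ (c 0) (c (suc k))
    μ₂ = μ (c (suc k)) (c L′)
    ih₁ : 2 * E₁ + μ₁ + 1 ≤ suc k + S₁
    ih₁ = ih (s≤s (s≤s k≤b)) c e (s≤s z≤n) bi
             (λ i i′ j j′ p q s t → nc i i′ j j′ p q s (≤-trans t (s≤s (m≤n⇒m≤1+n k≤b))))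
    ih₂ : 2 * E₂ + μ₂ + 1 ≤ suc r + S₂
    ih₂ = subst₂-≤ (ih (s≤s (s≤s (m≤n+m r k))) (λ i → c (suc k + i)) (shift (suc k) e) (s≤s z≤n)
             (λ i j → bi (suc k + i) (suc k + j))
             (λ i i′ j j′ p q s t → nc _ _ _ _ (+-monoʳ-< (suc k) p) (+-monoʳ-< (suc k) q) (+-monoʳ-< (suc k) s)
                 (≤-trans (+-monoʳ-≤ (suc k) t) (≤-reflexive L≡))))
      where
      subst₂-≤ : 2 * E₂ + μ (c (suc k + 0)) (c L′) + 1 ≤
                   suc r + ∑ (suc r) (spineWeight (λ i → c (suc k + i)) (shift (suc k) e)) →
                 2 * E₂ + μ₂ + 1 ≤ suc r + S₂
      subst₂-≤ p = ≤-trans (≤-reflexive (cong (λ a → 2 * E₂ + μ (c (suc a)) (c L′) + 1) (sym (+-identityʳ k))))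
        (≤-trans p (≤-reflexive (cong (suc r +_) (∑-cong (suc r) (λ i _ →
          cong (λ a → μ (c (suc k + i)) (c a) + 2 * e (suc k + i) a) (shift-+ i))))))
    main : 2 * ∑< (suc L′) e + μ (c 0) (c L′) + 1 ≤ L′ + ∑ L′ (spineWeight c e)
    main = begin
      2 * ∑< (suc L′) e + μ (c 0) (c L′) + 1           ≡⟨ cong (λ a → 2 * a + μ (c 0) (c L′) + 1) (∑<-split-chord k r e nothing-above) ⟩
      2 * (E₁ + E₂ + e 0 L′) + μ (c 0) (c L′) + 1      ≡⟨ regroup E₁ E₂ (e 0 L′) (μ (c 0) (c L′)) ⟩
      2 * E₁ + 2 * E₂ + 1 + (2 * e 0 L′ + μ (c 0) (c L′))
                                                       -- Each interval needs a summand `1` for its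
                                                       -- induction hypothesis; the second one comes
                                                       -- from this inequality.
                                                       ≤⟨ +-monoʳ-≤ (2 * E₁ + 2 * E₂ + 1) (chord-parity (c 0) (c (suc k)) (c L′) (e 0 L′) (bi 0 L′)) ⟩
      2 * E₁ + 2 * E₂ + 1 + (μ₁ + μ₂ + 1)              ≡⟨ regroup′ (2 * E₁) (2 * E₂) μ₁ μ₂ ⟩
      (2 * E₁ + μ₁ + 1) + (2 * E₂ + μ₂ + 1)            ≤⟨ +-mono-≤ ih₁ ih₂ ⟩
      (suc k + S₁) + (suc r + S₂)                      ≡⟨ regroup″ (suc k) S₁ (suc r) S₂ ⟩
      L′ + (S₁ + S₂)                                   ≡⟨ cong (L′ +_) (∑-split (suc k) (suc r) (spineWeight c e)) ⟨
      L′ + ∑ L′ (spineWeight c e)                      ∎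
      where
      open ≤-Reasoning
      regroup : ∀ a b x m → 2 * (a + b + x) + m + 1 ≡ 2 * a + 2 * b + 1 + (2 * x + m)
      regroup = solve-∀
      regroup′ : ∀ a b x y → a + b + 1 + (x + y + 1) ≡ (a + x + 1) + (b + y + 1)
      regroup′ = solve-∀
      regroup″ : ∀ a b x y → (a + b) + (x + y) ≡ (a + x) + (b + y)
      regroup″ = solve-∀

-- Queues

𝟙 : ∀ {P : Set} → Dec P → ℕ
𝟙 (yes _) = 1
𝟙 (no  _) = 0

𝟙≤1 : ∀ {P : Set} (P? : Dec P) → 𝟙 P? ≤ 1
𝟙≤1 (yes _) = ≤-refl
𝟙≤1 (no  _) = z≤n

𝟙-witness : ∀ {P : Set} (P? : Dec P) → 0 < 𝟙 P? → P
𝟙-witness (yes p) _ = p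

𝟙-true : ∀ {P : Set} (P? : Dec P) → P → 𝟙 P? ≡ 1
𝟙-true (yes _) p = refl
𝟙-true (no ¬p) p = contradiction p ¬p

NonNesting : ℕ → (ℕ → ℕ → ℕ) → Set
NonNesting N e = ∀ i i′ j j′ → i < i′ → i′ < j′ → j′ < j → j < N → 0 < e i j → 0 < e i′ j′ → ⊥

-- Two distinct edges with the same endpoint sum nest, so a queue has one edge per sum.
queue-bound : ∀ N a w (e : ℕ → ℕ → ℕ) → (∀ i j → e i j ≤ 1) →
  (∀ i j → 0 < e i j → a ≤ i + j × i + j < a + w) → NonNesting N e → ∑< N e ≤ w
queue-bound N a w e e≤1 window nn = begin
  ∑< N e                                                      ≤⟨ ∑<-mono N (λ i j _ _ → classify i j) ⟩
  ∑< N (λ i j → ∑ w (λ t → 𝟙 (i + j ≟ a + t) * e i j))        ≡⟨ ∑<-∑ N w (λ t i j → 𝟙 (i + j ≟ a + t) * e i j) ⟩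
  ∑ w (λ t → ∑< N (λ i j → 𝟙 (i + j ≟ a + t) * e i j))        ≤⟨ ∑-mono w (λ t _ → ∑<-unique N _ (λ i j _ _ → *-mono-≤ (𝟙≤1 (i + j ≟ a + t)) (e≤1 i j)) (unique t)) ⟩
  ∑ w (λ _ → 1)                                               ≡⟨ ∑-const w 1 ⟩
  w * 1                                                       ≡⟨ *-identityʳ w ⟩
  w                                                           ∎
  where
  open ≤-Reasoning
  -- The index `t` is the offset of the endpoint sum from the lower end `a` of the window.
  classify : ∀ i j → e i j ≤ ∑ w (λ t → 𝟙 (i + j ≟ a + t) * e i j)
  classify i j with e i j in eq
  ... | zero  = z≤n
  ... | suc x with window i j (subst (0 <_) (sym eq) (s≤s z≤n))
  ...   | a≤ , <a+w with m≤n⇒∃[o]m+o≡n a≤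
  ...     | t , a+t≡ = ≤-trans
    (≤-reflexive (sym (trans (cong (_* suc x) (𝟙-true (i + j ≟ a + t) (sym a+t≡))) (*-identityˡ (suc x)))))
    (term≤∑ (λ t → 𝟙 (i + j ≟ a + t) * suc x) (+-cancelˡ-< a t w (≤-trans (s≤s (≤-reflexive a+t≡)) <a+w)))
  both : ∀ x y → 0 < x * y → 0 < x × 0 < y
  both (suc x) (suc y) _ = s≤s z≤n , s≤s z≤n
  both (suc x) zero    p = contradiction (≤-trans p (≤-reflexive (*-zeroʳ x))) λ ()
  larger : ∀ i j i′ j′ → i + j ≡ i′ + j′ → i < i′ → j′ < j
  larger i j i′ j′ eq i<i′ = ≰⇒> (λ j≤j′ → <⇒≢ (+-mono-<-≤ i<i′ j≤j′) eq)
  unique : ∀ t i j i′ j′ → i < j → j < N → i′ < j′ → j′ < N →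
    0 < 𝟙 (i + j ≟ a + t) * e i j → 0 < 𝟙 (i′ + j′ ≟ a + t) * e i′ j′ → i ≡ i′ × j ≡ j′
  unique t i j i′ j′ i<j j<N i′<j′ j′<N p q with both (𝟙 (i + j ≟ a + t)) _ p | both (𝟙 (i′ + j′ ≟ a + t)) _ q
  ... | p₁ , p₂ | q₁ , q₂ with trans (𝟙-witness (i + j ≟ a + t) p₁) (sym (𝟙-witness (i′ + j′ ≟ a + t) q₁))
  ...   | eq with <-cmp i i′
  ...     | tri< i<i′ _ _ = ⊥-elim (nn i i′ j j′ i<i′ i′<j′ (larger i j i′ j′ eq i<i′) j<N p₂ q₂)
  ...     | tri> _ _ i′<i = ⊥-elim (nn i′ i j′ j i′<i i<j (larger i′ j′ i j (sym eq) i′<i) j′<N q₂ p₂)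
  ...     | tri≈ _ refl _ = refl , +-cancelˡ-≡ i j j′ eq

-- Counting the edges in the window of endpoint sums

𝟙-mono : ∀ {P Q : Set} (P? : Dec P) (Q? : Dec Q) → (P → Q) → 𝟙 P? ≤ 𝟙 Q?
𝟙-mono (no _)  Q? f = z≤n
𝟙-mono (yes p) Q? f = ≤-reflexive (sym (𝟙-true Q? (f p)))

𝟙-false : ∀ {P : Set} (P? : Dec P) → ¬ P → 𝟙 P? ≡ 0
𝟙-false (yes p) ¬p = contradiction p ¬p
𝟙-false (no _)  ¬p = refl

∑-restrict : ∀ n k (f : ℕ → ℕ) → ∑ n (λ i → 𝟙 (i <? k) * f i) ≤ ∑ k f
∑-restrict n k f with ≤-total n k
... | inj₁ n≤k = ≤-trans (∑-mono n (λ i _ → ≤-trans (*-monoˡ-≤ (f i) (𝟙≤1 (i <? k))) (≤-reflexive (*-identityˡ (f i)))))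
                         (∑-monoˡ f n≤k)
... | inj₂ k≤n with m≤n⇒∃[o]m+o≡n k≤n
...   | r , refl = ≤-trans (≤-reflexive (trans (∑-split k r _) (cong₂ _+_
          (∑-cong k (λ i i<k → trans (cong (_* f i) (𝟙-true (i <? k) i<k)) (*-identityˡ (f i))))
          (∑-zero r (λ i _ → cong (_* f (k + i)) (𝟙-false (k + i <? k) (≤⇒≯ (m≤m+n k i))))))))
        (≤-reflexive (+-identityʳ (∑ k f)))

∑²-reverse : ∀ n (g : ℕ → ℕ → ℕ) → ∑² n (λ i j → g (n ∸ suc i) (n ∸ suc j)) ≡ ∑² n g
∑²-reverse n g = trans (∑-cong n (λ i _ → ∑-reverse n (g (n ∸ suc i)))) (∑-reverse n (λ i → ∑ n (g i)))

∑²-mono : ∀ n {g h : ℕ → ℕ → ℕ} → (∀ i j → i < n → j < n → g i j ≤ h i j) → ∑² n g ≤ ∑² n h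
∑²-mono n p = ∑-mono n (λ i i<n → ∑-mono n (λ j j<n → p i j i<n j<n))

∑²-+ : ∀ n (g h : ℕ → ℕ → ℕ) → ∑² n (λ i j → g i j + h i j) ≡ ∑² n g + ∑² n h
∑²-+ n g h = trans (∑-cong n (λ i _ → ∑-+ n (g i) (h i))) (∑-+ n _ _)

-- The condition `j <? n ∸ i` encodes `i + j < n` row by row. In rows `i ≥ n` the truncated
-- difference is `0`, so only the triangle remains.
∑²-corner : ∀ n r (g : ℕ → ℕ → ℕ) → ∑² (n + r) (λ i j → 𝟙 (j <? n ∸ i) * g i j) ≤ ∑△ n g
∑²-corner n r g = begin
  ∑² (n + r) (λ i j → 𝟙 (j <? n ∸ i) * g i j)            ≤⟨ ∑-mono (n + r) (λ i _ → ∑-restrict (n + r) (n ∸ i) (g i)) ⟩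
  ∑ (n + r) (λ i → ∑ (n ∸ i) (g i))                      ≡⟨ ∑-split n r _ ⟩
  ∑△ n g + ∑ r (λ i → ∑ (n ∸ (n + i)) (g (n + i)))       ≡⟨ cong (∑△ n g +_) (∑-zero r (λ i _ → cong (λ a → ∑ a (g (n + i))) (m≤n⇒m∸n≡0 (m≤m+n n i)))) ⟩
  ∑△ n g + 0                                             ≡⟨ +-identityʳ _ ⟩
  ∑△ n g                                                 ∎
  where open ≤-Reasoning

-- A mixed layout of K_{n,n}, n = m + 1, on the positions 0, …, 2n - 1: pages are numbered so
-- that those below s are the stacks.
module PositionLayout
  (m s q : ℕ) (c : ℕ → Bool) (pg : ℕ → ℕ → ℕ)
  (balanced : ∀ a → ∑ (suc m + suc m) (λ j → δ a (c j)) ≡ suc m)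
  (pg<s+q : ∀ i j → pg i j < s + q)
  (stack : ∀ i i′ j j′ → i < i′ → i′ < j → j < j′ → j′ < suc m + suc m →
           0 < δ (c i) (c j) → 0 < δ (c i′) (c j′) → pg i j ≡ pg i′ j′ → pg i j < s → ⊥)
  (queue : ∀ i i′ j j′ → i < i′ → i′ < j′ → j′ < j → j < suc m + suc m →
           0 < δ (c i) (c j) → 0 < δ (c i′) (c j′) → pg i j ≡ pg i′ j′ → s ≤ pg i j → ⊥)
  where

  -- `L = N - 1` has two roles: it is the last position, and it is the number of endpoint sums `n`,
  -- ..., `n + L - 1` in the window.
  n N L : ℕ
  n = suc m
  N = n + n
  L = m + n

  d : ℕ → ℕ → ℕ
  d i j = δ (c i) (c j)

  InWindow : ℕ → ℕ → Set
  InWindow i j = 0 < d i j × n ≤ i + j × i + j < n + L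

  InWindow? : ∀ i j → Dec (InWindow i j)
  InWindow? i j = (0 <? d i j) ×-dec (n ≤? i + j) ×-dec (i + j <? n + L)

  InWindow-sym : ∀ i j → InWindow i j → InWindow j i
  InWindow-sym i j (p , l , u) =
    subst (0 <_) (δ-sym (c i) (c j)) p , subst (n ≤_) (+-comm i j) l , subst (_< n + L) (+-comm i j) u

  window : ℕ → ℕ → ℕ
  window i j = 𝟙 (InWindow? i j)

  window-sym : ∀ i j → window i j ≡ window j i
  window-sym i j = ≤-antisym (𝟙-mono (InWindow? i j) (InWindow? j i) (InWindow-sym i j))
                             (𝟙-mono (InWindow? j i) (InWindow? i j) (InWindow-sym j i))

  window-diagonal : ∀ i → window i i ≡ 0
  window-diagonal i = 𝟙-false (InWindow? i i) (λ (p , _) → <⇒≢ p (sym (δ-self (c i))))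

  window≤d : ∀ i j → window i j ≤ d i j
  window≤d i j with InWindow? i j
  ... | yes (p , _) = p
  ... | no  _       = z≤n

  -- Edges with sums outside the window

  lower upper : ℕ → ℕ → ℕ
  lower i j = 𝟙 (j <? n ∸ i) * d i j
  upper i j = 𝟙 (n + L ≤? i + j) * d i j

  d≤lower+upper+window : ∀ i j → d i j ≤ lower i j + upper i j + window i j
  d≤lower+upper+window i j = go (j <? n ∸ i) (n + L ≤? i + j) (InWindow? i j)
    where
    go : (P? : Dec (j < n ∸ i)) (Q? : Dec (n + L ≤ i + j)) (R? : Dec (InWindow i j)) →
         d i j ≤ 𝟙 P? * d i j + 𝟙 Q? * d i j + 𝟙 R?
    go (yes _) Q? R? = ≤-trans (≤-trans (≤-reflexive (sym (*-identityˡ (d i j)))) (m≤m+n _ _)) (m≤m+n _ (𝟙 R?))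
    go (no _) (yes _) R? = ≤-trans (≤-reflexive (sym (*-identityˡ (d i j)))) (m≤m+n _ (𝟙 R?))
    go (no _) (no _) (yes _) = δ≤1 (c i) (c j)
    go (no j≮) (no ≰) (no ¬w) = ≮⇒≥ λ p → ¬w (p , m∸n≤o⇒m≤n+o n i (≮⇒≥ j≮) , ≰⇒> ≰)
      where
      m∸n≤o⇒m≤n+o : ∀ a b {x} → a ∸ b ≤ x → a ≤ b + x
      m∸n≤o⇒m≤n+o a b p = ≤-trans (m≤n+m∸n a b) (+-monoʳ-≤ b p)

  lower-bound : 3 * ∑² N lower ≤ n * suc n
  lower-bound = ≤-trans (*-monoʳ-≤ 3 (∑²-corner n n d)) (∑△-δ≤ n c)

  -- Reversing the order replaces a sum `t` by `2 * L - t`, so the sums from `n + L` on become sums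
  -- of at most `L - n = n - 1`, and the bound for the lower corner applies to the reversed
  -- colouring.
  upper-bound : 3 * ∑² N upper ≤ n * suc n
  upper-bound = begin
    3 * ∑² N upper                                        ≡⟨ cong (3 *_) (∑²-reverse N upper) ⟨
    3 * ∑² N (λ i j → upper (r i) (r j))                  ≤⟨ *-monoʳ-≤ 3 (∑²-mono N (λ i j i<N j<N → *-monoˡ-≤ (d (r i) (r j)) (𝟙-mono (n + L ≤? r i + r j) (j <? n ∸ i) (reflect i j i<N j<N)))) ⟩
    3 * ∑² N (λ i j → 𝟙 (j <? n ∸ i) * d (r i) (r j))     ≤⟨ *-monoʳ-≤ 3 (∑²-corner n n (λ i j → d (r i) (r j))) ⟩
    3 * ∑△ n (λ i j → d (r i) (r j))                      ≤⟨ ∑△-δ≤ n (c ∘ r) ⟩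
    n * suc n                                             ∎
    where
    open ≤-Reasoning
    r : ℕ → ℕ
    r i = N ∸ suc i
    reflect : ∀ i j → i < N → j < N → n + L ≤ r i + r j → j < n ∸ i
    reflect i j i<N j<N p = m+n≤o⇒m≤o∸n (suc j) (+-cancelˡ-≤ (n + L + 1) (suc j + i) n (begin
      n + L + 1 + (suc j + i)              ≡⟨ rearrange (n + L) i j ⟩
      n + L + (suc i + suc j)              ≤⟨ +-monoˡ-≤ (suc i + suc j) p ⟩
      r i + r j + (suc i + suc j)          ≡⟨ interchange (r i) (r j) (suc i) (suc j) ⟩
      (r i + suc i) + (r j + suc j)        ≡⟨ cong₂ _+_ (m∸n+n≡m i<N) (m∸n+n≡m j<N) ⟩
      N + N                                ≡⟨ total m ⟩
      n + L + 1 + n                        ∎))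
      where
      rearrange : ∀ a i j → a + 1 + (1 + j + i) ≡ a + (1 + i + (1 + j))
      rearrange = solve-∀
      interchange : ∀ a b x y → a + b + (x + y) ≡ (a + x) + (b + y)
      interchange = solve-∀
      total : ∀ m → (1 + m + (1 + m)) + (1 + m + (1 + m)) ≡ 1 + m + (m + (1 + m)) + 1 + (1 + m)
      total = solve-∀

  -- Each of the `N` positions has `n` neighbours, so the left side counts every edge twice. Both
  -- corners are counted by ordered pairs as well, and the window by twice its edges.
  edges≤ : N * n ≤ ∑² N lower + ∑² N upper + (∑< N window + ∑< N window)
  edges≤ = begin
    N * n                                              ≡⟨ ∑-const N n ⟨
    ∑ N (λ _ → n)                                      ≡⟨ ∑-cong N (λ i _ → balanced (c i)) ⟨
    ∑² N d                                             ≤⟨ ∑²-mono N (λ i j _ _ → d≤lower+upper+window i j) ⟩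
    ∑² N (λ i j → lower i j + upper i j + window i j)  ≡⟨ ∑²-+ N (λ i j → lower i j + upper i j) window ⟩
    ∑² N (λ i j → lower i j + upper i j) + ∑² N window ≡⟨ cong₂ _+_ (∑²-+ N lower upper) (∑²-symmetric N window window-sym window-diagonal) ⟩
    ∑² N lower + ∑² N upper + (∑< N window + ∑< N window) ∎
    where open ≤-Reasoning

  -- Window edges on the individual pages

  onPage? : ∀ k i j → Dec (InWindow i j × pg i j ≡ k)
  onPage? k i j = InWindow? i j ×-dec (pg i j ≟ k)

  onPage : ℕ → ℕ → ℕ → ℕ
  onPage k i j = 𝟙 (onPage? k i j)

  page-of : ∀ k i j → 0 < onPage k i j → InWindow i j × pg i j ≡ k
  page-of k i j = 𝟙-witness (onPage? k i j)

  onPage≤window : ∀ k i j → onPage k i j ≤ window i j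
  onPage≤window k i j = 𝟙-mono (onPage? k i j) (InWindow? i j) proj₁

  window≤∑onPage : ∀ i j → window i j ≤ ∑ (s + q) (λ k → onPage k i j)
  window≤∑onPage i j = ≤-trans (𝟙-mono (InWindow? i j) (onPage? (pg i j) i j) (_, refl))
                               (term≤∑ (λ k → onPage k i j) (pg<s+q i j))

  -- Every edge has only one page. Hence the edges of consecutive vertices are charged once over all
  -- stacks together.
  ∑onPage≤window : ∀ r i j → ∑ r (λ k → onPage k i j) ≤ window i j
  ∑onPage≤window r i j = go (InWindow? i j)
    where
    go : (w : Dec (InWindow i j)) → ∑ r (λ k → onPage k i j) ≤ 𝟙 w
    go (yes _) = ∑-unique r _ (λ k _ → 𝟙≤1 (onPage? k i j))
      (λ k l _ _ p q → trans (sym (proj₂ (page-of k i j p))) (proj₂ (page-of l i j q)))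
    go (no ¬w) = ≤-reflexive (∑-zero r (λ k _ → 𝟙-false (onPage? k i j) (¬w ∘ proj₁)))

  queue-page : ∀ k → ∑< N (onPage (s + k)) ≤ L
  queue-page k = queue-bound N n L (onPage (s + k)) (λ i j → 𝟙≤1 (onPage? (s + k) i j))
    (λ i j p → proj₂ (proj₁ (page-of (s + k) i j p)))
    (λ i i′ j j′ i<i′ i′<j′ j′<j j<N p q →
      let (δ₁ , _) , pg₁ = page-of (s + k) i j p
          (δ₂ , _) , pg₂ = page-of (s + k) i′ j′ q
      in queue i i′ j j′ i<i′ i′<j′ j′<j j<N δ₁ δ₂ (trans pg₁ (sym pg₂)) (subst (s ≤_) (sym pg₁) (m≤m+n s k)))

  M : ℕ
  M = ∑ L (λ i → μ (c i) (c (suc i)))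

  spine : ℕ
  spine = ∑ L (λ i → window i (suc i))

  stack-page : ∀ k → k < s → 2 * ∑< N (onPage k) ≤ L + M + 2 * ∑ L (λ i → onPage k i (suc i))
  stack-page k k<s = begin
    2 * ∑< N (onPage k)                                     ≤⟨ ≤-trans (m≤m+n _ (μ (c 0) (c L))) (m≤m+n _ 1) ⟩
    2 * ∑< N (onPage k) + μ (c 0) (c L) + 1                 ≤⟨ stack-bound L c (onPage k) (≤-trans (s≤s z≤n) (m≤n+m n m)) (λ i j → ≤-trans (onPage≤window k i j) (window≤d i j)) nonCrossing ⟩
    L + ∑ L (spineWeight c (onPage k))                      ≡⟨ cong (L +_) (∑-+ L _ _) ⟩
    L + (M + ∑ L (λ i → 2 * onPage k i (suc i)))            ≡⟨ cong (λ a → L + (M + a)) (∑-*ˡ L 2 _) ⟩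
    L + (M + 2 * ∑ L (λ i → onPage k i (suc i)))            ≡⟨ +-assoc L M _ ⟨
    L + M + 2 * ∑ L (λ i → onPage k i (suc i))              ∎
    where
    open ≤-Reasoning
    nonCrossing : NonCrossing L (onPage k)
    nonCrossing i i′ j j′ i<i′ i′<j j<j′ j′≤L p q =
      let (δ₁ , _) , pg₁ = page-of k i j p
          (δ₂ , _) , pg₂ = page-of k i′ j′ q
      in stack i i′ j j′ i<i′ i′<j j<j′ (s≤s j′≤L) δ₁ δ₂ (trans pg₁ (sym pg₂)) (subst (_< s) (sym pg₁) k<s)

  -- Each of the `L` gaps either has equal colours or carries at most one edge, never both.
  spine+M≤L : spine + M ≤ L
  spine+M≤L = begin
    spine + M                                                     ≡⟨ ∑-+ L _ _ ⟨
    ∑ L (λ i → window i (suc i) + μ (c i) (c (suc i)))            ≤⟨ ∑-mono L (λ i _ → ≤-trans (+-monoˡ-≤ (μ (c i) (c (suc i))) (window≤d i (suc i))) (≤-reflexive (trans (+-comm (d i (suc i)) _) (μ+δ≡1 (c i) (c (suc i)))))) ⟩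
    ∑ L (λ _ → 1)                                                 ≡⟨ trans (∑-const L 1) (*-identityʳ L) ⟩
    L                                                             ∎
    where open ≤-Reasoning

  -- The sums 2i + 1 and 2(n + i) + 1 are too far apart to lie both in the window.
  spine≤n : spine ≤ n
  spine≤n = begin
    ∑ L w                              ≤⟨ ∑-monoˡ w (n≤1+n L) ⟩
    ∑ (n + n) w                        ≡⟨ ∑-split n n w ⟩
    ∑ n w + ∑ n (λ i → w (n + i))      ≡⟨ ∑-+ n w (λ i → w (n + i)) ⟨
    ∑ n (λ i → w i + w (n + i))        ≤⟨ ∑-mono n (λ i _ → exclusive i) ⟩
    ∑ n (λ _ → 1)                      ≡⟨ trans (∑-const n 1) (*-identityʳ n) ⟩
    n                                  ∎
    where
    open ≤-Reasoning
    w : ℕ → ℕ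
    w i = window i (suc i)
    apart : ∀ i → n ≤ i + suc i → n + i + suc (n + i) < n + L → ⊥
    apart i p u = <-irrefl refl (begin-strict
      n + L                       <⟨ n<1+n (n + L) ⟩
      suc (n + L)                 ≡⟨ below m ⟩
      n + n + n                   ≤⟨ +-monoʳ-≤ (n + n) p ⟩
      n + n + (i + suc i)         ≡⟨ regroup n i ⟩
      n + i + suc (n + i)         <⟨ u ⟩
      n + L                       ∎)
      where
      below : ∀ m → 1 + (1 + m + (m + (1 + m))) ≡ 1 + m + (1 + m) + (1 + m)
      below = solve-∀
      regroup : ∀ a i → a + a + (i + (1 + i)) ≡ a + i + (1 + (a + i))
      regroup = solve-∀
    exclusive : ∀ i → w i + w (n + i) ≤ 1
    exclusive i with InWindow? i (suc i) | InWindow? (n + i) (suc (n + i))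
    ... | no _           | w?               = 𝟙≤1 w?
    ... | yes _          | no _             = ≤-refl
    ... | yes (_ , p , _) | yes (_ , _ , u) = ⊥-elim (apart i p u)

  -- The term `2 * spine` is paid in two parts: one copy joins the `M` of a single stack through
  -- `spine+M≤L`, the other is at most `n`. The remaining stacks use `M ≤ L`. This takes at least
  -- one stack, so the number `r` is split into cases.
  stack-pages : ∀ r → r ≤ s → 2 * ∑ r (λ k → ∑< N (onPage k)) ≤ r * (2 * L) + n
  stack-pages zero    _   = z≤n
  stack-pages (suc r) r<s = begin
    2 * ∑ (suc r) (λ k → ∑< N (onPage k))                                    ≡⟨ ∑-*ˡ (suc r) 2 (λ k → ∑< N (onPage k)) ⟨
    ∑ (suc r) (λ k → 2 * ∑< N (onPage k))                                    ≤⟨ ∑-mono (suc r) (λ k k<r → stack-page k (≤-trans k<r r<s)) ⟩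
    ∑ (suc r) (λ k → L + M + 2 * ∑ L (λ i → onPage k i (suc i)))             ≡⟨ ∑-+ (suc r) (λ _ → L + M) (λ k → 2 * ∑ L (λ i → onPage k i (suc i))) ⟩
    ∑ (suc r) (λ k → L + M) + ∑ (suc r) (λ k → 2 * ∑ L (λ i → onPage k i (suc i)))
                                                                             ≡⟨ cong₂ _+_ (∑-const (suc r) (L + M)) (trans (∑-*ˡ (suc r) 2 (λ k → ∑ L (λ i → onPage k i (suc i)))) (cong (2 *_) (∑-swap (suc r) L (λ k i → onPage k i (suc i))))) ⟩
    suc r * (L + M) + 2 * ∑ L (λ i → ∑ (suc r) (λ k → onPage k i (suc i)))   ≤⟨ +-monoʳ-≤ (suc r * (L + M)) (*-monoʳ-≤ 2 (∑-mono L (λ i _ → ∑onPage≤window (suc r) i (suc i)))) ⟩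
    suc r * (L + M) + 2 * spine                                              ≡⟨ regroup r L M spine ⟩
    r * (L + M) + (L + (spine + M)) + spine                                  ≤⟨ +-mono-≤ (+-mono-≤ (*-monoʳ-≤ r (+-monoʳ-≤ L M≤L)) (+-monoʳ-≤ L spine+M≤L)) spine≤n ⟩
    r * (L + L) + (L + L) + n                                                ≡⟨ collect r L n ⟩
    suc r * (2 * L) + n                                                      ∎
    where
    open ≤-Reasoning
    M≤L : M ≤ L
    M≤L = ≤-trans (m≤n+m M spine) spine+M≤L
    regroup : ∀ r L M w → (1 + r) * (L + M) + 2 * w ≡ r * (L + M) + (L + (w + M)) + w
    regroup = solve-∀
    collect : ∀ r L n → r * (L + L) + (L + L) + n ≡ (1 + r) * (2 * L) + n
    collect = solve-∀

  window-bound : 2 * ∑< N window ≤ (s + q) * (2 * L) + n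
  window-bound = begin
    2 * ∑< N window                                                        ≤⟨ *-monoʳ-≤ 2 (∑<-mono N (λ i j _ _ → window≤∑onPage i j)) ⟩
    2 * ∑< N (λ i j → ∑ (s + q) (λ k → onPage k i j))                      ≡⟨ cong (2 *_) (∑<-∑ N (s + q) onPage) ⟩
    2 * ∑ (s + q) (λ k → ∑< N (onPage k))                                  ≡⟨ cong (2 *_) (∑-split s q _) ⟩
    2 * (∑ s (λ k → ∑< N (onPage k)) + ∑ q (λ k → ∑< N (onPage (s + k))))  ≡⟨ *-distribˡ-+ 2 (∑ s (λ k → ∑< N (onPage k))) _ ⟩
    2 * ∑ s (λ k → ∑< N (onPage k)) + 2 * ∑ q (λ k → ∑< N (onPage (s + k)))
                                                                           ≤⟨ +-mono-≤ (stack-pages s ≤-refl) (*-monoʳ-≤ 2 (∑-mono q (λ k _ → queue-page k))) ⟩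
    s * (2 * L) + n + 2 * ∑ q (λ _ → L)                                    ≡⟨ cong (λ a → s * (2 * L) + n + 2 * a) (∑-const q L) ⟩
    s * (2 * L) + n + 2 * (q * L)                                          ≡⟨ collect s q L n ⟩
    (s + q) * (2 * L) + n                                                  ∎
    where
    open ≤-Reasoning
    collect : ∀ s q L n → s * (2 * L) + n + 2 * (q * L) ≡ (s + q) * (2 * L) + n
    collect = solve-∀

  -- The final inequality

  counting : 3 * (N * n) ≤ 2 * (n * suc n) + 3 * (s + q) * (2 * L) + 3 * n
  counting = begin
    3 * (N * n)                              ≤⟨ *-monoʳ-≤ 3 edges≤ ⟩
    3 * (A + B + (T + T))                    ≡⟨ regroup A B T ⟩
    3 * A + 3 * B + 3 * (2 * T)              ≤⟨ +-mono-≤ (+-mono-≤ lower-bound upper-bound) (*-monoʳ-≤ 3 window-bound) ⟩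
    n * suc n + n * suc n + 3 * ((s + q) * (2 * L) + n)
                                             ≡⟨ collect (n * suc n) (s + q) (2 * L) n ⟩
    2 * (n * suc n) + 3 * (s + q) * (2 * L) + 3 * n ∎
    where
    open ≤-Reasoning
    A = ∑² N lower
    B = ∑² N upper
    T = ∑< N window
    regroup : ∀ a b t → 3 * (a + b + (t + t)) ≡ 3 * a + 3 * b + 3 * (2 * t)
    regroup = solve-∀
    collect : ∀ x p y n → x + x + 3 * (p * y + n) ≡ 2 * x + 3 * p * y + 3 * n
    collect = solve-∀

  -- If `3 * (s + q) ≤ m`, the two sides of `counting` become quadratics in `m` that differ by `m`
  -- against `1`, so `m ≤ 1`. But there is at least one page, which forces `3 ≤ m`.
  n≤3pages : n ≤ 3 * (s + q)
  n≤3pages = ≮⇒≥ λ 3p<n → contradiction (m≤1 (s≤s⁻¹ 3p<n)) (<⇒≱ (≤-trans (s≤s (s≤s z≤n)) (≤-trans 3≤3p (s≤s⁻¹ 3p<n))))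
    where
    open ≤-Reasoning
    3≤3p : 3 ≤ 3 * (s + q)
    -- The page number of the pair `(0, 0)` lies below `s + q`, so `s + q` is positive.
    3≤3p = *-monoʳ-≤ 3 (≤-trans (s≤s z≤n) (pg<s+q 0 0))
    left : ∀ m → 3 * ((1 + m + (1 + m)) * (1 + m)) ≡ 6 * m * m + 11 * m + 6 + m
    left = solve-∀
    right : ∀ m → 2 * ((1 + m) * (1 + (1 + m))) + m * (2 * (m + (1 + m))) + 3 * (1 + m) ≡ 6 * m * m + 11 * m + 6 + 1
    right = solve-∀
    m≤1 : 3 * (s + q) ≤ m → m ≤ 1
    m≤1 3p≤m = +-cancelˡ-≤ (6 * m * m + 11 * m + 6) m 1 (begin
      6 * m * m + 11 * m + 6 + m                            ≡⟨ left m ⟨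
      3 * (N * n)                                           ≤⟨ counting ⟩
      2 * (n * suc n) + 3 * (s + q) * (2 * L) + 3 * n       ≤⟨ +-monoˡ-≤ (3 * n) (+-monoʳ-≤ (2 * (n * suc n)) (*-monoˡ-≤ (2 * L) 3p≤m)) ⟩
      2 * (n * suc n) + m * (2 * L) + 3 * n                 ≡⟨ right m ⟩
      6 * m * m + 11 * m + 6 + 1                            ∎)

-- Ranks of the vertices

-- The default value past the end of the list makes the lookup total, so that positions can be plain
-- natural numbers.
nth : ∀ {A : Set} → A → List A → ℕ → A
nth a []       i       = a
nth a (x ∷ xs) zero    = x
nth a (x ∷ xs) (suc i) = nth a xs i

∑-nth : ∀ {A : Set} (a : A) xs (f : A → ℕ) → ∑ (length xs) (f ∘ nth a xs) ≡ sum (map f xs)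
∑-nth a []       f = refl
∑-nth a (x ∷ xs) f = cong (f x +_) (∑-nth a xs f)

nth-All : ∀ {A : Set} {P : A → Set} (a : A) {xs} → All P xs → ∀ {i} → i < length xs → P (nth a xs i)
nth-All a (p ∷ ps) {zero}  _       = p
nth-All a (p ∷ ps) {suc i} (s≤s l) = nth-All a ps l

nth-AllPairs : ∀ {A : Set} {R : A → A → Set} (a : A) {xs} → AllPairs R xs →
               ∀ {i j} → i < j → j < length xs → R (nth a xs i) (nth a xs j)
nth-AllPairs a (r ∷ rs) {zero}  {suc j} _         (s≤s j<) = nth-All a r j<
nth-AllPairs a (r ∷ rs) {suc i} {suc j} (s≤s i<j) (s≤s j<) = nth-AllPairs a rs i<j j<

sum-map-const : ∀ {A : Set} (f : A → ℕ) k xs → (∀ x → f x ≡ k) → sum (map f xs) ≡ length xs * k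
sum-map-const f k []       h = refl
sum-map-const f k (x ∷ xs) h = cong₂ _+_ (h x) (sum-map-const f k xs h)

isLeft : ∀ {n} → Vertex n → Bool
isLeft (inj₁ _) = true
isLeft (inj₂ _) = false

vertices : ∀ n → List (Vertex n)
vertices n = map inj₁ (allFin n) ++ map inj₂ (allFin n)

vertices-length : ∀ n → length (vertices n) ≡ n + n
vertices-length n = trans (length-++ (map inj₁ (allFin n))) (cong₂ _+_ (half inj₁) (half inj₂))
  where
  half : (f : Fin n → Vertex n) → length (map f (allFin n)) ≡ n
  half f = trans (length-map f (allFin n)) (length-tabulate _)

vertices-unique : ∀ n → Unique (vertices n)
vertices-unique n = Unique.++⁺ (Unique.map⁺ (λ { refl → refl }) (Unique.allFin⁺ n))
                               (Unique.map⁺ (λ { refl → refl }) (Unique.allFin⁺ n)) disjoint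
  where
  disjoint : Disjoint (map inj₁ (allFin n)) (map inj₂ (allFin n))
  disjoint (p , q) with ∈-map⁻ inj₁ p | ∈-map⁻ inj₂ q
  ... | _ , _ , refl | _ , _ , ()

-- Exactly one of the two parts has a colour different from `a`, and it has `n` vertices.
vertices-balanced : ∀ n a → sum (map (δ a ∘ isLeft) (vertices n)) ≡ n
vertices-balanced n a = begin
  sum (map f (vertices n))                                         ≡⟨ cong sum (map-++ f (map inj₁ (allFin n)) _) ⟩
  sum (map f (map inj₁ (allFin n)) ++ map f (map inj₂ (allFin n))) ≡⟨ sum-++ (map f (map inj₁ (allFin n))) _ ⟩
  sum (map f (map inj₁ (allFin n))) + sum (map f (map inj₂ (allFin n)))
                                                                   ≡⟨ cong₂ _+_ (half inj₁ (δ a true) (λ _ → refl)) (half inj₂ (δ a false) (λ _ → refl)) ⟩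
  n * δ a true + n * δ a false                                     ≡⟨ *-distribˡ-+ n (δ a true) (δ a false) ⟨
  n * (δ a true + δ a false)                                       ≡⟨ cong (n *_) (one a) ⟩
  n * 1                                                            ≡⟨ *-identityʳ n ⟩
  n                                                                ∎
  where
  open ≡-Reasoning
  f : Vertex n → ℕ
  f = δ a ∘ isLeft
  half : (g : Fin n → Vertex n) → ∀ k → (∀ i → f (g i) ≡ k) → sum (map f (map g (allFin n))) ≡ n * k
  half g k h = trans (cong sum (sym (map-∘ (allFin n))))
    (trans (sum-map-const (f ∘ g) k (allFin n) h) (cong (_* k) (length-tabulate {n = n} _)))
  one : ∀ a → δ a true + δ a false ≡ 1
  one true  = refl
  one false = refl

-- On two vertices of the same part the value is irrelevant.
edge : ∀ {n} → Vertex n → Vertex n → Edge n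
edge (inj₁ i) (inj₂ j) = i , j
edge (inj₂ j) (inj₁ i) = i , j
edge (inj₁ i) (inj₁ _) = i , i
edge (inj₂ j) (inj₂ _) = j , j

-- The colour hypothesis excludes the arbitrary values of `edge`, and the order of the positions
-- decides the minimum and the maximum.
edge-ends : ∀ {n} (σ : VertexOrder n) u v → 0 < δ (isLeft u) (isLeft v) → pos σ u < pos σ v →
            endL σ (edge u v) ≡ pos σ u × endR σ (edge u v) ≡ pos σ v
edge-ends σ (inj₁ i) (inj₂ j) _ u<v = m≤n⇒m⊓n≡m (<⇒≤ u<v) , m≤n⇒m⊔n≡n (<⇒≤ u<v)
edge-ends σ (inj₂ j) (inj₁ i) _ u<v = m≥n⇒m⊓n≡n (<⇒≤ u<v) , m≥n⇒m⊔n≡m (<⇒≤ u<v)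

-- Numbering of the pages, stacks first

pageNumber : ∀ s q → Fin s ⊎ Fin q → ℕ
pageNumber s q p = toℕ (join s q p)

pageNumber-injective : ∀ s q {p p′} → pageNumber s q p ≡ pageNumber s q p′ → p ≡ p′
pageNumber-injective s q {p} {p′} eq =
  trans (sym (splitAt-join s q p)) (trans (cong (splitAt s) (toℕ-injective eq)) (splitAt-join s q p′))

pageNumber-stack : ∀ s q p → pageNumber s q p < s → ∃[ k ] p ≡ inj₁ k
pageNumber-stack s q (inj₁ k) _ = k , refl
pageNumber-stack s q (inj₂ k) l = contradiction (subst (_< s) (toℕ-↑ʳ s k) l) (≤⇒≯ (m≤m+n s (toℕ k)))

pageNumber-queue : ∀ s q p → s ≤ pageNumber s q p → ∃[ k ] p ≡ inj₂ k
pageNumber-queue s q (inj₁ k) l = contradiction (subst (_< s) (sym (toℕ-↑ˡ k q)) (toℕ<n k)) (≤⇒≯ l)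
pageNumber-queue s q (inj₂ k) _ = k , refl

-- Sorting by `pos` replaces arbitrary positions by the ranks `0`, ..., `2n - 1`; `v₀` is the
-- default value for `nth`.
module Ranks {n : ℕ} (σ : VertexOrder n) (v₀ : Vertex n) where

  open import Data.List.Sort (On.decTotalOrder ≤-decTotalOrder (pos σ)) using (sort; sort-↭; sort-↗)

  sorted : List (Vertex n)
  sorted = sort (vertices n)

  sorted-length : length sorted ≡ n + n
  sorted-length = trans (↭-length (sort-↭ (vertices n))) (vertices-length n)

  sorted-strictly : AllPairs (λ u v → pos σ u < pos σ v) sorted
  -- Sorting gives only a weak order; it is strict because no vertex is repeated and `pos` is
  -- injective.
  sorted-strictly = AllPairs.zipWith (λ (u≤v , u≢v) → ≤∧≢⇒< u≤v (u≢v ∘ pos-inj σ))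
    ( Sorted⇒AllPairs (On.totalOrder ≤-totalOrder (pos σ)) (sort-↗ (vertices n))
    , Unique-resp-↭ (setoid (Vertex n)) (↭⇒↭ₛ (↭-sym (sort-↭ (vertices n)))) (vertices-unique n))

  vertex : ℕ → Vertex n
  vertex = nth v₀ sorted

  vertex-mono : ∀ {i j} → i < j → j < n + n → pos σ (vertex i) < pos σ (vertex j)
  vertex-mono i<j j<N = nth-AllPairs v₀ sorted-strictly i<j (subst (_ <_) (sym sorted-length) j<N)

  vertex-balanced : ∀ a → ∑ (n + n) (λ i → δ a (isLeft (vertex i))) ≡ n
  vertex-balanced a = begin
    ∑ (n + n) (f ∘ vertex)          ≡⟨ cong (λ l → ∑ l (f ∘ vertex)) sorted-length ⟨
    ∑ (length sorted) (f ∘ vertex)  ≡⟨ ∑-nth v₀ sorted f ⟩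
    sum (map f sorted)              ≡⟨ sum-↭ (map⁺ f (sort-↭ (vertices n))) ⟩
    sum (map f (vertices n))        ≡⟨ vertices-balanced n a ⟩
    n                               ∎
    where
    open ≡-Reasoning
    f : Vertex n → ℕ
    f = δ a ∘ isLeft

-- From a layout of the vertices to a layout of the ranks

module _ {m s q : ℕ} (ℓ : MixedLayout (suc m) s q) where

  open MixedLayout ℓ
  open Ranks order (inj₁ zero)

  edgeAt : ℕ → ℕ → Edge (suc m)
  edgeAt i j = edge (vertex i) (vertex j)

  edgeAt-ends : ∀ {i j} → i < j → j < suc m + suc m → 0 < δ (isLeft (vertex i)) (isLeft (vertex j)) →
                endL order (edgeAt i j) ≡ pos order (vertex i) × endR order (edgeAt i j) ≡ pos order (vertex j)
  edgeAt-ends i<j j<N p = edge-ends order _ _ p (vertex-mono i<j j<N)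

  pageAt : ℕ → ℕ → ℕ
  pageAt i j = pageNumber s q (page (edgeAt i j))

  stack-positions : ∀ i i′ j j′ → i < i′ → i′ < j → j < j′ → j′ < suc m + suc m →
    0 < δ (isLeft (vertex i)) (isLeft (vertex j)) → 0 < δ (isLeft (vertex i′)) (isLeft (vertex j′)) →
    pageAt i j ≡ pageAt i′ j′ → pageAt i j < s → ⊥
  stack-positions i i′ j j′ i<i′ i′<j j<j′ j′<N p p′ eq l
    with edgeAt-ends (<-trans i<i′ i′<j) (<-trans j<j′ j′<N) p | edgeAt-ends (<-trans i′<j j<j′) j′<N p′
       | pageNumber-stack s q _ l
  ... | l≡ , r≡ | l′≡ , r′≡ | k , page≡ = stack-ok (edgeAt i j) (edgeAt i′ j′) k page≡
    (trans (sym (pageNumber-injective s q eq)) page≡)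
    (inj₁ ( subst₂ _<_ (sym l≡) (sym l′≡) (vertex-mono i<i′ (<-trans i′<j (<-trans j<j′ j′<N)))
          , subst₂ _<_ (sym l′≡) (sym r≡) (vertex-mono i′<j (<-trans j<j′ j′<N))
          , subst₂ _<_ (sym r≡) (sym r′≡) (vertex-mono j<j′ j′<N)))

  queue-positions : ∀ i i′ j j′ → i < i′ → i′ < j′ → j′ < j → j < suc m + suc m →
    0 < δ (isLeft (vertex i)) (isLeft (vertex j)) → 0 < δ (isLeft (vertex i′)) (isLeft (vertex j′)) →
    pageAt i j ≡ pageAt i′ j′ → s ≤ pageAt i j → ⊥
  queue-positions i i′ j j′ i<i′ i′<j′ j′<j j<N p p′ eq l
    with edgeAt-ends (<-trans i<i′ (<-trans i′<j′ j′<j)) j<N p | edgeAt-ends i′<j′ (<-trans j′<j j<N) p′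
       | pageNumber-queue s q _ l
  ... | l≡ , r≡ | l′≡ , r′≡ | k , page≡ = queue-ok (edgeAt i j) (edgeAt i′ j′) k page≡
    (trans (sym (pageNumber-injective s q eq)) page≡)
    (inj₁ ( subst₂ _<_ (sym l≡) (sym l′≡) (vertex-mono i<i′ (<-trans i′<j′ (<-trans j′<j j<N)))
          , subst₂ _<_ (sym l′≡) (sym r′≡) (vertex-mono i′<j′ (<-trans j′<j j<N))
          , subst₂ _<_ (sym r′≡) (sym r≡) (vertex-mono j′<j j<N)))

  parts≤3pages : suc m ≤ 3 * (s + q)
  parts≤3pages = PositionLayout.n≤3pages m s q (isLeft ∘ vertex) pageAt vertex-balanced
    (λ i j → toℕ<n (join s q (page (edgeAt i j)))) stack-positions queue-positions

theorem5 : ∀ (n : ℕ) → 1 ≤ n → ∀ (s q : ℕ) → MixedLayout n s q → ⌈ n /3⌉ ≤ s + q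
theorem5 (suc m) _ s q ℓ = begin
  (suc m + 2) / 3          ≤⟨ /-monoˡ-≤ 3 (+-monoˡ-≤ 2 (parts≤3pages ℓ)) ⟩
  (3 * (s + q) + 2) / 3    ≡⟨ cong (λ a → (a + 2) / 3) (*-comm 3 (s + q)) ⟩
  -- The rounding term `2` is less than `3`, so it adds nothing to the quotient of a multiple of
  -- `3`.
  ((s + q) * 3 + 2) / 3    ≡⟨ +-distrib-/-∣ˡ 2 (n∣m*n (s + q)) ⟩
  (s + q) * 3 / 3 + 2 / 3  ≡⟨ +-identityʳ _ ⟩
  (s + q) * 3 / 3          ≡⟨ m*n/n≡m (s + q) 3 ⟩
  s + q                    ∎
  where open ≤-Reasoning
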